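{- (1) The functors $\coprod^{\mathbb{S}}\colon[\mathbb{S},\mathbf{Set}]\to\mathbf{Relev}_{=}$ and $\mathcal{S}^{\mathbb{S}}\colon\mathbf{Relev}_{=}\to[\mathbb{S},\mathbf{Set}]$ constitute an equivalence of categories: $\mathbf{Relev}_{=}\simeq[\mathbb{S},\mathbf{Set}]$. (2) The monad $\mathcal{T}$ on $\mathbf{Nom}_{=}$ lifts to a monad $\overline{\mathcal{T}}$ on $\mathbf{Relev}_{=}$, and the category $\mathbf{Relev}$ is isomorphic to the Kleisli category of $\overline{\mathcal{T}}$, that is, $\mathbf{Relev}\cong(\mathbf{Relev}_{=})_{\overline{\mathcal{T}}}$.
   Context: $\mathbb{A}$ is a countably infinite set of names and $\mathrm{Perm}\,\mathbb{A}$ its group of finite permutations. A nominal set is a $\mathrm{Perm}\,\mathbb{A}$-set in which every element has a finite support; $\operatorname{supp}x$ is the least one. $\mathbf{Nom}_{=}$ is the category of nominal sets and equivariant maps $f$ that are support-preserving: $\operatorname{supp}f(x)=\operatorname{supp}x$ for all $x$. A renaming is a map $\rho\colon\mathbb{A}\to\mathbb{A}$ with $\rho a=a$ for all but finitely many $a$; $\mathrm{Ren}\,\mathbb{A}$ is the monoid of renamings. A renaming set is a set $X$ with an action of $\mathrm{Ren}\,\mathbb{A}$ such that every $x\in X$ has a finite support, i.e. a finite $A\subseteq\mathbb{A}$ such that $\rho|_A=\mathrm{id}_A$ implies $\rho\cdot x=x$; then $x$ has a least finite support $\operatorname{supp}x$. $\mathbf{Ren}$ is the category of renaming sets and equivariant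 maps. A renaming set $X$ is a relevance set if $\rho[\operatorname{supp}x]=\operatorname{supp}(\rho\cdot x)$ for all $\rho\in\mathrm{Ren}\,\mathbb{A}$ and $x\in X$. $\mathbf{Relev}$ is the full subcategory of $\mathbf{Ren}$ of relevance sets, and $\mathbf{Relev}_{=}$ its subcategory of support-preserving equivariant maps. There is a forgetful functor $\mathbf{Relev}_{=}\to\mathbf{Nom}_{=}$ restricting the action to permutations, and "lifts" is meant along this functor. $\mathbb{S}$ is the category of finite sets and surjections, identified with the equivalent small category of finite subsets of $\mathbb{A}$ and surjections. The functor $\coprod^{\mathbb{S}}$ maps $F\in[\mathbb{S},\mathbf{Set}]$ to $\coprod_{A\subseteq_{\mathrm{fin}}\mathbb{A}}FA$, with injections $\kappa_A$ and action $\rho\cdot\kappa_A(x)=\kappa_{\rho[A]}(F(\rho|_A^{\rho[A]})(x))$, where $\rho|_A^{\rho[A]}\colon A\twoheadrightarrow\rho[A]$ is the restriction. The functor $\mathcal{S}^{\mathbb{S}}$ maps $X$ to the presheaf $\mathcal{S}^{\mathbb{S}}X(A)=\{x\in X\mid\operatorname{supp}x=A\}$ with $\mathcal{S}^{\mathbb{S}}X(f)(x)=\rho_f\cdot x$ for any renaming $\rho_f$ extending the surjection $f\colon A\twoheadrightarrow B$; on morphisms it acts by restriction. $\mathcal{T}$ is the monad on $\mathbf{Nom}_{=}$ induced by the inclusion $\mathbf{Nom}_{=}\hookrightarrow\mathbf{Nom}$ (into nominal sets and all equivariant maps) and its right adjoint: $\mathcal{T}X=\{(x,A)\mid x\in X,\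 A\subseteq_{\mathrm{fin}}\mathbb{A},\ \operatorname{supp}x\subseteq A\}$ with action $\pi\cdot(x,A)=(\pi\cdot x,\pi[A])$, unit $x\mapsto(x,\operatorname{supp}x)$ and multiplication $((x,A),B)\mapsto(x,A\cup B)=(x,B)$. -}

module Defs where

open import Algebra.Bundles using (Group; Monoid)
open import Data.List.Base using (List; []; _∷_; _++_; map)
open import Data.List.Membership.Propositional using (_∈_; _∉_)
open import Data.List.Membership.Propositional.Properties
  using (∈-map⁺; ∈-map⁻; ∈-++⁺ˡ; ∈-++⁺ʳ)
open import Data.List.Relation.Binary.Subset.Propositional using (_⊆_)
open import Data.List.Relation.Unary.Any using (here; there)
open import Data.Nat.Base using (ℕ; _≤_)
open import Data.Nat.ListAction using (sum)
import Data.Nat.Properties as ℕ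
open import Data.Product.Base using (Σ; ∃; _×_; _,_; proj₁; proj₂; Σ-syntax)
open import Function.Base using (_∘′_; case_of_) renaming (id to idᶠ)
open import Function.Bundles using (_↔_; Inverse; Func; Surjection; mk↔ₛ′)
import Function.Construct.Composition as Comp
import Function.Construct.Identity as Ident
open import Function.Properties.Inverse using (Inverse⇒Injection; ↔-sym)
open import Level using (Level; _⊔_; 0ℓ)
open import Relation.Binary.Bundles using (Setoid)
import Relation.Binary.Construct.On as On
open import Relation.Binary.Definitions using (DecidableEquality)
open import Relation.Binary.PropositionalEquality.Core as ≡
  using (_≡_; _≢_; cong; subst₂)
import Relation.Binary.PropositionalEquality.Properties as ≡
import Relation.Binary.Reasoning.Setoid as SetoidReasoning
open import Relation.Binary.Structures using (IsEquivalence)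
open import Relation.Nullary.Decidable using (yes; no; via-injection)
open import Relation.Nullary.Negation using (contradiction)

private
  variable
    o m e o′ m′ e′ o″ m″ e″ : Level

record Category (o m e : Level) : Set (Level.suc (o ⊔ m ⊔ e)) where
  infix  4 _⇒_ _≈_
  infixr 9 _∘_
  field
    Obj       : Set o
    _⇒_       : Obj → Obj → Set m
    _≈_       : ∀ {A B} → A ⇒ B → A ⇒ B → Set e
    id        : ∀ {A} → A ⇒ A
    _∘_       : ∀ {A B C} → B ⇒ C → A ⇒ B → A ⇒ C
    equiv     : ∀ {A B} → IsEquivalence (_≈_ {A} {B})
    ∘-resp-≈  : ∀ {A B C} {f h : B ⇒ C} {g i : A ⇒ B} →
                f ≈ h → g ≈ i → f ∘ g ≈ h ∘ i
    identityˡ : ∀ {A B} {f : A ⇒ B} → id ∘ f ≈ f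
    identityʳ : ∀ {A B} {f : A ⇒ B} → f ∘ id ≈ f
    assoc     : ∀ {A B C D} {f : A ⇒ B} {g : B ⇒ C} {h : C ⇒ D} →
                (h ∘ g) ∘ f ≈ h ∘ (g ∘ f)

  hom : Obj → Obj → Setoid m e
  hom A B = record { isEquivalence = equiv {A} {B} }

  module Equiv {A B : Obj} = IsEquivalence (equiv {A} {B})

record Functor (C : Category o m e) (D : Category o′ m′ e′) :
               Set (o ⊔ m ⊔ e ⊔ o′ ⊔ m′ ⊔ e′) where
  private
    module C = Category C
    module D = Category D
  field
    F₀           : C.Obj → D.Obj
    F₁           : ∀ {A B} → A C.⇒ B → F₀ A D.⇒ F₀ B
    F-resp-≈     : ∀ {A B} {f g : A C.⇒ B} → f C.≈ g → F₁ f D.≈ F₁ g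
    identity     : ∀ {A} → F₁ (C.id {A}) D.≈ D.id
    homomorphism : ∀ {A B C} {f : A C.⇒ B} {g : B C.⇒ C} →
                   F₁ (g C.∘ f) D.≈ F₁ g D.∘ F₁ f

idF : (C : Category o m e) → Functor C C
idF C = record
  { F₀ = idᶠ
  ; F₁ = idᶠ
  ; F-resp-≈ = idᶠ
  ; identity = Category.Equiv.refl C
  ; homomorphism = Category.Equiv.refl C
  }

infixr 9 _∘F_
_∘F_ : {C : Category o m e} {D : Category o′ m′ e′} {E : Category o″ m″ e″} →
       Functor D E → Functor C D → Functor C E
_∘F_ {E = E} G F = record
  { F₀ = λ A → G.F₀ (F.F₀ A)
  ; F₁ = λ f → G.F₁ (F.F₁ f)
  ; F-resp-≈ = λ f≈g → G.F-resp-≈ (F.F-resp-≈ f≈g)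
  ; identity = E.trans (G.F-resp-≈ F.identity) G.identity
  ; homomorphism = E.trans (G.F-resp-≈ F.homomorphism) G.homomorphism
  }
  where
  module F = Functor F
  module G = Functor G
  module E = Category.Equiv E

record NaturalTransformation {C : Category o m e} {D : Category o′ m′ e′}
                             (F G : Functor C D) :
                             Set (o ⊔ m ⊔ e ⊔ o′ ⊔ m′ ⊔ e′) where
  private
    module C = Category C
    module D = Category D
    module F = Functor F
    module G = Functor G
  field
    η       : ∀ A → F.F₀ A D.⇒ G.F₀ A
    natural : ∀ {A B} (f : A C.⇒ B) → η B D.∘ F.F₁ f D.≈ G.F₁ f D.∘ η A

functorCategory : Category o m e → Category o′ m′ e′ →
                  Category (o ⊔ m ⊔ e ⊔ o′ ⊔ m′ ⊔ e′) (o ⊔ m ⊔ e ⊔ o′ ⊔ m′ ⊔ e′) (o ⊔ e′)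
functorCategory C D = record
  { Obj = Functor C D
  ; _⇒_ = NaturalTransformation
  ; _≈_ = λ α β → ∀ A → η α A D.≈ η β A
  ; id = λ {F} → record
    { η = λ A → D.id
    ; natural = λ f → D.Equiv.trans D.identityˡ (D.Equiv.sym D.identityʳ)
    }
  ; _∘_ = λ {F} {G} {H} β α → record
    { η = λ A → η β A D.∘ η α A
    ; natural = λ {A} {B} f →
        let open SetoidReasoning (D.hom (F₀ F A) (F₀ H B)) in begin
        (η β B D.∘ η α B) D.∘ F₁ F f   ≈⟨ D.assoc ⟩
        η β B D.∘ (η α B D.∘ F₁ F f)   ≈⟨ D.∘-resp-≈ D.Equiv.refl (natural α f) ⟩
        η β B D.∘ (F₁ G f D.∘ η α A)   ≈⟨ D.assoc ⟨
        (η β B D.∘ F₁ G f) D.∘ η α A   ≈⟨ D.∘-resp-≈ (natural β f) D.Equiv.refl ⟩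
        (F₁ H f D.∘ η β A) D.∘ η α A   ≈⟨ D.assoc ⟩
        F₁ H f D.∘ (η β A D.∘ η α A)   ∎
    }
  ; equiv = record
    { refl = λ A → D.Equiv.refl
    ; sym = λ p A → D.Equiv.sym (p A)
    ; trans = λ p q A → D.Equiv.trans (p A) (q A)
    }
  ; ∘-resp-≈ = λ p q A → D.∘-resp-≈ (p A) (q A)
  ; identityˡ = λ A → D.identityˡ
  ; identityʳ = λ A → D.identityʳ
  ; assoc = λ A → D.assoc
  }
  where
  module D = Category D
  open Functor
  open NaturalTransformation

record Iso (C : Category o m e) (A B : Category.Obj C) : Set (m ⊔ e) where
  open Category C
  field
    to    : A ⇒ B
    from  : B ⇒ A
    to∘from : to ∘ from ≈ id
    from∘to : from ∘ to ≈ id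

NaturalIsomorphism : {C : Category o m e} {D : Category o′ m′ e′} →
                     Functor C D → Functor C D → Set (o ⊔ m ⊔ e ⊔ o′ ⊔ m′ ⊔ e′)
NaturalIsomorphism {C = C} {D} = Iso (functorCategory C D)

record IsCategoryEquivalence {C : Category o m e} {D : Category o′ m′ e′}
                             (F : Functor C D) (G : Functor D C) :
                             Set (o ⊔ m ⊔ e ⊔ o′ ⊔ m′ ⊔ e′) where
  field
    unit   : NaturalIsomorphism (idF C) (G ∘F F)
    counit : NaturalIsomorphism (F ∘F G) (idF D)

-- Equality (not isomorphism) of functors: objects are compared by _≡_, and
-- morphisms by _≈_ after transport.
record _≡F_ {C : Category o m e} {D : Category o′ m′ e′} (F G : Functor C D) :
            Set (o ⊔ m ⊔ o′ ⊔ e′) where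
  private
    module C = Category C
    module D = Category D
    module F = Functor F
    module G = Functor G
  field
    obj≡ : ∀ A → F.F₀ A ≡ G.F₀ A
    mor≡ : ∀ {A B} (f : A C.⇒ B) →
           subst₂ D._⇒_ (obj≡ A) (obj≡ B) (F.F₁ f) D.≈ G.F₁ f

record _≅Cat_ (C : Category o m e) (D : Category o′ m′ e′) :
              Set (o ⊔ m ⊔ e ⊔ o′ ⊔ m′ ⊔ e′) where
  field
    to      : Functor C D
    from    : Functor D C
    to∘from : (to ∘F from) ≡F idF D
    from∘to : (from ∘F to) ≡F idF C

record Monad (C : Category o m e) : Set (o ⊔ m ⊔ e) where
  open Category C
  field
    T    : Functor C C
    unit : NaturalTransformation (idF C) T
    mult : NaturalTransformation (T ∘F T) T

  open Functor T public renaming (F₀ to T₀; F₁ to T₁)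
  open NaturalTransformation unit public renaming (η to η; natural to η-natural)
  open NaturalTransformation mult public renaming (η to μ; natural to μ-natural)

  field
    μ-assoc     : ∀ {A} → μ A ∘ T₁ (μ A) ≈ μ A ∘ μ (T₀ A)
    μ-identityˡ : ∀ {A} → μ A ∘ T₁ (η A) ≈ id
    μ-identityʳ : ∀ {A} → μ A ∘ η (T₀ A) ≈ id

Kleisli : {C : Category o m e} → Monad C → Category o m e
Kleisli {C = C} M = record
  { Obj = Obj
  ; _⇒_ = λ A B → A ⇒ T₀ B
  ; _≈_ = _≈_
  ; id = λ {A} → η A
  ; _∘_ = λ {A} {B} {C} g f → μ C ∘ (T₁ g ∘ f)
  ; equiv = equiv
  ; ∘-resp-≈ = λ p q → ∘-resp-≈ refl (∘-resp-≈ (F-resp-≈ p) q)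
  ; identityˡ = λ {A} {B} {f} → trans (sym assoc) (trans (∘-resp-≈ μ-identityˡ refl) identityˡ)
  ; identityʳ = λ {A} {B} {f} →
      let open SetoidReasoning (hom A (T₀ B)) in begin
      μ B ∘ (T₁ f ∘ η A)       ≈⟨ ∘-resp-≈ refl (η-natural f) ⟨
      μ B ∘ (η (T₀ B) ∘ f)     ≈⟨ assoc ⟨
      (μ B ∘ η (T₀ B)) ∘ f     ≈⟨ ∘-resp-≈ μ-identityʳ refl ⟩
      id ∘ f                   ≈⟨ identityˡ ⟩
      f                        ∎
  ; assoc = λ {A} {B} {C} {D} {f} {g} {h} →
      let open SetoidReasoning (hom A (T₀ D)) in begin
      μ D ∘ (T₁ (μ D ∘ (T₁ h ∘ g)) ∘ f)
        ≈⟨ ∘-resp-≈ refl (∘-resp-≈ (trans homomorphism (∘-resp-≈ refl homomorphism)) refl) ⟩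
      μ D ∘ ((T₁ (μ D) ∘ (T₁ (T₁ h) ∘ T₁ g)) ∘ f)
        ≈⟨ ∘-resp-≈ refl assoc ⟩
      μ D ∘ (T₁ (μ D) ∘ ((T₁ (T₁ h) ∘ T₁ g) ∘ f))
        ≈⟨ assoc ⟨
      (μ D ∘ T₁ (μ D)) ∘ ((T₁ (T₁ h) ∘ T₁ g) ∘ f)
        ≈⟨ ∘-resp-≈ μ-assoc assoc ⟩
      (μ D ∘ μ (T₀ D)) ∘ (T₁ (T₁ h) ∘ (T₁ g ∘ f))
        ≈⟨ trans assoc (∘-resp-≈ refl (sym assoc)) ⟩
      μ D ∘ ((μ (T₀ D) ∘ T₁ (T₁ h)) ∘ (T₁ g ∘ f))
        ≈⟨ ∘-resp-≈ refl (∘-resp-≈ (μ-natural h) refl) ⟩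
      μ D ∘ ((T₁ h ∘ μ C) ∘ (T₁ g ∘ f))
        ≈⟨ ∘-resp-≈ refl assoc ⟩
      μ D ∘ (T₁ h ∘ (μ C ∘ (T₁ g ∘ f)))  ∎
  }
  where
  open Category C
  open Equiv
  open Monad M

-- The full subcategory on the objects U i, and more generally the category with
-- objects I and the morphisms of C between their images.
fullSubcategory : ∀ {i} (C : Category o m e) {I : Set i} → (I → Category.Obj C) →
                  Category i m e
fullSubcategory C {I} U = record
  { Obj = I
  ; _⇒_ = λ i j → U i ⇒ U j
  ; _≈_ = _≈_
  ; id = C.id
  ; _∘_ = _∘_
  ; equiv = equiv
  ; ∘-resp-≈ = ∘-resp-≈
  ; identityˡ = identityˡ
  ; identityʳ = identityʳ
  ; assoc = assoc
  }
  where
  module C = Category C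
  open C

-- Sets are setoids, so that quotients such as the coproduct over finite subsets
-- exist; functions are compared pointwise.
Sets : (ℓ : Level) → Category (Level.suc ℓ) ℓ ℓ
Sets ℓ = record
  { Obj = Setoid ℓ ℓ
  ; _⇒_ = Func
  ; _≈_ = λ {A} {B} f g → ∀ x → Setoid._≈_ B (Func.to f x) (Func.to g x)
  ; id = λ {A} → Ident.function A
  ; _∘_ = λ g f → Comp.function f g
  ; equiv = λ {A} {B} → record
    { refl = λ x → Setoid.refl B
    ; sym = λ p x → Setoid.sym B (p x)
    ; trans = λ p q x → Setoid.trans B (p x) (q x)
    }
  ; ∘-resp-≈ = λ {A} {B} {C} {f} {h} {g} {i} p q x →
      Setoid.trans C (Func.cong f (q x)) (p (Func.to i x))
  ; identityˡ = λ {A} {B} x → Setoid.refl B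
  ; identityʳ = λ {A} {B} x → Setoid.refl B
  ; assoc = λ {A} {B} {C} {D} x → Setoid.refl D
  }

module Names (𝔸 : Set) (𝔸↔ℕ : 𝔸 ↔ ℕ) where

  open Inverse 𝔸↔ℕ using () renaming (to to index; from to name)

  _≟_ : DecidableEquality 𝔸
  _≟_ = via-injection (Inverse⇒Injection 𝔸↔ℕ) ℕ._≟_

  open import Data.List.Membership.DecPropositional _≟_ using (_∈?_)

  -- Finite subsets of 𝔸 are lists, equal when they have the same elements.
  FinSubset : Set
  FinSubset = List 𝔸

  infix 4 _≐_
  _≐_ : FinSubset → FinSubset → Set
  A ≐ B = A ⊆ B × B ⊆ A

  ≐-refl : ∀ {A} → A ≐ A
  ≐-refl = idᶠ , idᶠ

  ≐-sym : ∀ {A B} → A ≐ B → B ≐ A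
  ≐-sym (p , q) = q , p

  ≐-trans : ∀ {A B C} → A ≐ B → B ≐ C → A ≐ C
  ≐-trans (p , q) (r , s) = (λ z → r (p z)) , (λ z → q (s z))

  map-⊆ : ∀ {A B} {f g : 𝔸 → 𝔸} → (∀ {a} → a ∈ A → f a ≡ g a) → A ⊆ B → map f A ⊆ map g B
  map-⊆ {f = f} {g} f≗g A⊆B b∈ with ∈-map⁻ f b∈
  ... | a , a∈A , ≡.refl = ≡.subst (_∈ map g _) (≡.sym (f≗g a∈A)) (∈-map⁺ g (A⊆B a∈A))

  map-≐ : ∀ {A B} {f g : 𝔸 → 𝔸} → (∀ {a} → a ∈ A → f a ≡ g a) → A ≐ B → map f A ≐ map g B
  map-≐ f≗g (p , q) = map-⊆ f≗g p , map-⊆ (λ b∈B → ≡.sym (f≗g (q b∈B))) q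

  map-id-≐ : ∀ {A} {f : 𝔸 → 𝔸} → (∀ {a} → a ∈ A → f a ≡ a) → map f A ≐ A
  map-id-≐ {A} {f} fixes = to , λ {a} a∈A → ≡.subst (_∈ map f A) (fixes a∈A) (∈-map⁺ f a∈A)
    where
    to : map f A ⊆ A
    to b∈ with ∈-map⁻ f b∈
    ... | a , a∈A , ≡.refl = ≡.subst (_∈ A) (≡.sym (fixes a∈A)) a∈A

  map-∘-≐ : ∀ {A} (f g : 𝔸 → 𝔸) → map (f ∘′ g) A ≐ map f (map g A)
  map-∘-≐ {A} f g = to , from
    where
    to : map (f ∘′ g) A ⊆ map f (map g A)
    to b∈ with ∈-map⁻ (f ∘′ g) b∈
    ... | a , a∈A , ≡.refl = ∈-map⁺ f (∈-map⁺ g a∈A)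
    from : map f (map g A) ⊆ map (f ∘′ g) A
    from c∈ with ∈-map⁻ f c∈
    ... | b , b∈ , ≡.refl with ∈-map⁻ g b∈
    ... | a , a∈A , ≡.refl = ∈-map⁺ (f ∘′ g) a∈A

  fresh : FinSubset → 𝔸
  fresh A = name (ℕ.suc (sum (map index A)))

  fresh∉ : ∀ A → fresh A ∉ A
  fresh∉ A p = ℕ.1+n≰n (≡.subst (_≤ sum (map index A)) (Inverse.inverseˡ 𝔸↔ℕ ≡.refl) (bound p))
    where
    bound : ∀ {a B} → a ∈ B → index a ≤ sum (map index B)
    bound (here ≡.refl) = ℕ.m≤m+n _ _
    bound {B = b ∷ _} (there q) = ℕ.≤-trans (bound q) (ℕ.m≤n+m _ (index b))

  record Renaming : Set where
    field
      apply  : 𝔸 → 𝔸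
      moved  : FinSubset
      fixed  : ∀ {a} → a ∉ moved → apply a ≡ a

  open Renaming public using () renaming (apply to infixl 8 _⟨_⟩)

  RenMonoid : Monoid 0ℓ 0ℓ
  RenMonoid = record
    { Carrier = Renaming
    ; _≈_ = λ ρ σ → ∀ a → ρ ⟨ a ⟩ ≡ σ ⟨ a ⟩
    ; _∙_ = λ ρ σ → record
      { apply = λ a → ρ ⟨ σ ⟨ a ⟩ ⟩
      ; moved = moved ρ ++ moved σ
      ; fixed = λ a∉ → ≡.trans
          (cong (apply ρ) (fixed σ (λ a∈ → a∉ (∈-++⁺ʳ (moved ρ) a∈))))
          (fixed ρ (λ a∈ → a∉ (∈-++⁺ˡ a∈)))
      }
    ; ε = record { apply = idᶠ ; moved = [] ; fixed = λ _ → ≡.refl }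
    ; isMonoid = record
      { isSemigroup = record
        { isMagma = record
          { isEquivalence = record
            { refl = λ a → ≡.refl
            ; sym = λ p a → ≡.sym (p a)
            ; trans = λ p q a → ≡.trans (p a) (q a)
            }
          ; ∙-cong = λ {ρ} {ρ′} {σ} {σ′} p q a → ≡.trans (cong (apply ρ) (q a)) (p (σ′ ⟨ a ⟩))
          }
        ; assoc = λ ρ σ τ a → ≡.refl
        }
      ; identity = (λ ρ a → ≡.refl) , (λ ρ a → ≡.refl)
      }
    }
    where open Renaming

  record Permutation : Set where
    field
      bijection : 𝔸 ↔ 𝔸
    open Inverse bijection public using (to; from; strictlyInverseˡ; strictlyInverseʳ)
    field
      moved : FinSubset
      fixed : ∀ {a} → a ∉ moved → to a ≡ a

  toRenaming : Permutation → Renaming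
  toRenaming π = record { apply = to ; moved = moved ; fixed = fixed }
    where open Permutation π

  PermGroup : Group 0ℓ 0ℓ
  PermGroup = record
    { Carrier = Permutation
    ; _≈_ = λ π σ → ∀ a → to π a ≡ to σ a
    ; _∙_ = λ π σ → record
      { bijection = Comp.inverse (bijection σ) (bijection π)
      ; moved = moved π ++ moved σ
      ; fixed = λ a∉ → ≡.trans
          (cong (to π) (fixed σ (λ a∈ → a∉ (∈-++⁺ʳ (moved π) a∈))))
          (fixed π (λ a∈ → a∉ (∈-++⁺ˡ a∈)))
      }
    ; ε = record { bijection = Ident.inverse (≡.setoid 𝔸) ; moved = [] ; fixed = λ _ → ≡.refl }
    ; _⁻¹ = λ π → record
      { bijection = ↔-sym (bijection π)
      ; moved = moved π
      ; fixed = λ {a} a∉ → ≡.trans (cong (from π) (≡.sym (fixed π a∉))) (strictlyInverseʳ π a)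
      }
    ; isGroup = record
      { isMonoid = record
        { isSemigroup = record
          { isMagma = record
            { isEquivalence = record
              { refl = λ a → ≡.refl
              ; sym = λ p a → ≡.sym (p a)
              ; trans = λ p q a → ≡.trans (p a) (q a)
              }
            ; ∙-cong = λ {π} {π′} {σ} {σ′} p q a → ≡.trans (cong (to π) (q a)) (p (to σ′ a))
            }
          ; assoc = λ π σ τ a → ≡.refl
          }
        ; identity = (λ π a → ≡.refl) , (λ π a → ≡.refl)
        }
      ; inverse = strictlyInverseʳ , strictlyInverseˡ
      ; ⁻¹-cong = λ {π} {σ} p a → ≡.trans
          (≡.sym (strictlyInverseʳ σ (from π a)))
          (cong (from σ) (≡.trans (≡.sym (p (from π a))) (strictlyInverseˡ π a)))
      }
    }
    where open Permutation

  transpose : 𝔸 → 𝔸 → 𝔸 → 𝔸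
  transpose a b c with c ≟ a | c ≟ b
  ... | yes _ | _     = b
  ... | no _  | yes _ = a
  ... | no _  | no _  = c

  transpose-left : ∀ a b → transpose a b a ≡ b
  transpose-left a b with a ≟ a | a ≟ b
  ... | yes _ | _ = ≡.refl
  ... | no ¬p | _ = contradiction ≡.refl ¬p

  transpose-right : ∀ a b → transpose a b b ≡ a
  transpose-right a b with b ≟ a | b ≟ b
  ... | yes p | _     = p
  ... | no _  | yes _ = ≡.refl
  ... | no _  | no ¬p = contradiction ≡.refl ¬p

  transpose-other : ∀ {a b c} → c ≢ a → c ≢ b → transpose a b c ≡ c
  transpose-other {a} {b} {c} c≢a c≢b with c ≟ a | c ≟ b
  ... | yes p | _     = contradiction p c≢a
  ... | no _  | yes q = contradiction q c≢b
  ... | no _  | no _  = ≡.refl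

  transpose-involutive : ∀ a b c → transpose a b (transpose a b c) ≡ c
  transpose-involutive a b c = case c ≟ a of λ where
    (yes ≡.refl) → ≡.trans (cong (transpose a b) (transpose-left a b)) (transpose-right a b)
    (no c≢a) → case c ≟ b of λ where
      (yes ≡.refl) → ≡.trans (cong (transpose a b) (transpose-right a b)) (transpose-left a b)
      (no c≢b) → ≡.trans (cong (transpose a b) (transpose-other c≢a c≢b)) (transpose-other c≢a c≢b)

  swap : 𝔸 → 𝔸 → Permutation
  swap a b = record
    { bijection = mk↔ₛ′ (transpose a b) (transpose a b)
                        (transpose-involutive a b) (transpose-involutive a b)
    ; moved = a ∷ b ∷ []
    ; fixed = λ c∉ → transpose-other (λ p → c∉ (here p)) (λ p → c∉ (there (here p)))
    }

  -- If A is mapped onto itself by every permutation fixing B, then A ⊆ B.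
  invariant⇒⊆ : ∀ A B →
    (∀ π → (∀ {a} → a ∈ B → Permutation.to π a ≡ a) → A ⊆ map (Permutation.to π) A) → A ⊆ B
  invariant⇒⊆ A B invariant {a} a∈A with a ∈? B
  ... | yes a∈B = a∈B
  ... | no a∉B = contradiction (invariant (swap a c) fixes a∈A) a∉
    where
    c : 𝔸
    c = fresh (A ++ B)
    c∉A : c ∉ A
    c∉A p = fresh∉ (A ++ B) (∈-++⁺ˡ p)
    c∉B : c ∉ B
    c∉B p = fresh∉ (A ++ B) (∈-++⁺ʳ A p)
    fixes : ∀ {b} → b ∈ B → transpose a c b ≡ b
    fixes b∈B = transpose-other (λ { ≡.refl → a∉B b∈B }) (λ { ≡.refl → c∉B b∈B })
    a∉ : a ∉ map (transpose a c) A
    a∉ p with ∈-map⁻ (transpose a c) p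
    ... | a′ , a′∈A , a≡ = c∉A (≡.subst (_∈ A) a′≡c a′∈A)
      where
      a′≡c : a′ ≡ c
      a′≡c = ≡.trans (≡.sym (transpose-involutive a c a′))
               (≡.trans (cong (transpose a c) (≡.sym a≡)) (transpose-left a c))

  -- The instances below are M = Perm 𝔸 (nominal sets) and M = Ren 𝔸 (renaming sets).
  module FinitelySupported (M : Monoid 0ℓ 0ℓ) (_$_ : Monoid.Carrier M → 𝔸 → 𝔸) where

    private module M = Monoid M

    record FSSet (ℓ : Level) : Set (Level.suc ℓ) where
      field
        setoid : Setoid ℓ ℓ
      open Setoid setoid public
      infixr 7 _·_
      field
        _·_    : M.Carrier → Carrier → Carrier
        ·-cong : ∀ {s t x y} → s M.≈ t → x ≈ y → s · x ≈ t · y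
        ·-ε    : ∀ x → M.ε · x ≈ x
        ·-∙    : ∀ s t x → (s M.∙ t) · x ≈ s · t · x

      Supports : FinSubset → Carrier → Set ℓ
      Supports A x = ∀ s → (∀ {a} → a ∈ A → s $ a ≡ a) → s · x ≈ x

      IsLeastSupport : FinSubset → Carrier → Set ℓ
      IsLeastSupport A x = Supports A x × (∀ B → Supports B x → A ⊆ B)

      -- For both instances an element with a finite support classically has a
      -- least one; constructively the least one must be asked for.
      field
        finitelySupported : ∀ x → ∃ λ A → IsLeastSupport A x

      supp : Carrier → FinSubset
      supp x = proj₁ (finitelySupported x)

      supp-supports : ∀ x → Supports (supp x) x
      supp-supports x = proj₁ (proj₂ (finitelySupported x))

      supp-least : ∀ {B} x → Supports B x → supp x ⊆ B
      supp-least x = proj₂ (proj₂ (finitelySupported x)) _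

      supp-cong : ∀ {x y} → x ≈ y → supp x ≐ supp y
      supp-cong x≈y = half x≈y , half (sym x≈y)
        where
        half : ∀ {x y} → x ≈ y → supp x ⊆ supp y
        half {x} {y} x≈y = supp-least x λ s fixes →
          trans (·-cong M.refl x≈y) (trans (supp-supports y s fixes) (sym x≈y))

    record EquivariantMap {ℓ} (X Y : FSSet ℓ) : Set ℓ where
      private
        module X = FSSet X
        module Y = FSSet Y
      field
        func : Func X.setoid Y.setoid
      open Func func public using (to) renaming (cong to to-cong)
      field
        equivariant : ∀ s x → to (s X.· x) Y.≈ s Y.· to x

      supp-⊆ : ∀ x → Y.supp (to x) ⊆ X.supp x
      supp-⊆ x = Y.supp-least (to x) λ s fixes →
        Y.trans (Y.sym (equivariant s x)) (to-cong (X.supp-supports x s fixes))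

    record SuppPreservingMap {ℓ} (X Y : FSSet ℓ) : Set ℓ where
      private
        module X = FSSet X
        module Y = FSSet Y
      field
        equivariantMap : EquivariantMap X Y
      open EquivariantMap equivariantMap public
      field
        supp-preserving : ∀ x → Y.supp (to x) ≐ X.supp x

    category : ∀ ℓ → Category (Level.suc ℓ) ℓ ℓ
    category ℓ = record
      { Obj = FSSet ℓ
      ; _⇒_ = EquivariantMap
      ; _≈_ = λ f g → func f Sets.≈ func g
      ; id = λ {X} → record { func = Sets.id ; equivariant = λ s x → FSSet.refl X }
      ; _∘_ = λ {X} {Y} {Z} g f → record
        { func = func g Sets.∘ func f
        ; equivariant = λ s x → FSSet.trans Z
            (to-cong g (equivariant f s x)) (equivariant g s (to f x))
        }
      ; equiv = λ {X} {Y} → On.isEquivalence func (Sets.equiv {FSSet.setoid X} {FSSet.setoid Y})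
      ; ∘-resp-≈ = λ {X} {Y} {Z} {f} {h} {g} {i} → Sets.∘-resp-≈ {f = func f} {func h} {func g} {func i}
      ; identityˡ = λ {X} {Y} x → FSSet.refl Y
      ; identityʳ = λ {X} {Y} x → FSSet.refl Y
      ; assoc = λ {W} {X} {Y} {Z} x → FSSet.refl Z
      }
      where
      module Sets = Category (Sets ℓ)
      open EquivariantMap

    category₌ : ∀ ℓ → Category (Level.suc ℓ) ℓ ℓ
    category₌ ℓ = record
      { Obj = FSSet ℓ
      ; _⇒_ = SuppPreservingMap
      ; _≈_ = λ f g → equivariantMap f C.≈ equivariantMap g
      ; id = record { equivariantMap = C.id ; supp-preserving = λ x → ≐-refl }
      ; _∘_ = λ g f → record
        { equivariantMap = equivariantMap g C.∘ equivariantMap f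
        ; supp-preserving = λ x → ≐-trans (supp-preserving g (to f x)) (supp-preserving f x)
        }
      ; equiv = λ {X} {Y} → On.isEquivalence equivariantMap (C.equiv {X} {Y})
      ; ∘-resp-≈ = λ {X} {Y} {Z} {f} {h} {g} {i} →
          C.∘-resp-≈ {f = equivariantMap f} {equivariantMap h} {equivariantMap g} {equivariantMap i}
      ; identityˡ = λ {X} {Y} x → FSSet.refl Y
      ; identityʳ = λ {X} {Y} x → FSSet.refl Y
      ; assoc = λ {W} {X} {Y} {Z} x → FSSet.refl Z
      }
      where
      module C = Category (category ℓ)
      open SuppPreservingMap

  module Perm = FinitelySupported (Group.monoid PermGroup) Permutation.to
  module Ren  = FinitelySupported RenMonoid Renaming.apply

  NominalSet : ∀ ℓ → Set (Level.suc ℓ)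
  NominalSet = Perm.FSSet

  RenamingSet : ∀ ℓ → Set (Level.suc ℓ)
  RenamingSet = Ren.FSSet

  Nom₌ : ∀ ℓ → Category (Level.suc ℓ) ℓ ℓ
  Nom₌ = Perm.category₌

  record RelevanceSet (ℓ : Level) : Set (Level.suc ℓ) where
    field
      renamingSet : RenamingSet ℓ
    open Ren.FSSet renamingSet public
    field
      relevant : ∀ ρ x → map (Renaming.apply ρ) (supp x) ≐ supp (ρ · x)

  open RelevanceSet public using (renamingSet)

  Relev : ∀ ℓ → Category (Level.suc ℓ) ℓ ℓ
  Relev ℓ = fullSubcategory (Ren.category ℓ) renamingSet

  Relev₌ : ∀ ℓ → Category (Level.suc ℓ) ℓ ℓ
  Relev₌ ℓ = fullSubcategory (Ren.category₌ ℓ) renamingSet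

  restrictAction : ∀ {ℓ} → RelevanceSet ℓ → NominalSet ℓ
  restrictAction X = record
    { setoid = setoid
    ; _·_ = λ π x → toRenaming π · x
    ; ·-cong = ·-cong
    ; ·-ε = λ x → trans (·-cong (λ a → ≡.refl) refl) (·-ε x)
    ; ·-∙ = λ π σ x → trans (·-cong (λ a → ≡.refl) refl) (·-∙ (toRenaming π) (toRenaming σ) x)
    ; finitelySupported = λ x →
        supp x
      , (λ π → supp-supports x (toRenaming π))
      , (λ B B-supports → invariant⇒⊆ (supp x) B λ π fixes a∈ →
           proj₂ (relevant (toRenaming π) x) (proj₂ (supp-cong (B-supports π fixes)) a∈))
    }
    where
    open RelevanceSet X

  forget : ∀ ℓ → Functor (Relev₌ ℓ) (Nom₌ ℓ)
  forget ℓ = record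
    { F₀ = restrictAction
    ; F₁ = λ f → record
      { equivariantMap = record
        { func = func f
        ; equivariant = λ π → equivariant f (toRenaming π)
        }
      ; supp-preserving = supp-preserving f
      }
    ; F-resp-≈ = idᶠ
    ; identity = λ {X} x → RelevanceSet.refl X
    ; homomorphism = λ {X} {Y} {Z} x → RelevanceSet.refl Z
    }
    where open Ren.SuppPreservingMap

  Elements : FinSubset → Setoid 0ℓ 0ℓ
  Elements A = On.setoid {B = ∃ (_∈ A)} (≡.setoid 𝔸) proj₁

  𝕊 : Category 0ℓ 0ℓ 0ℓ
  𝕊 = record
    { Obj = FinSubset
    ; _⇒_ = λ A B → Surjection (Elements A) (Elements B)
    ; _≈_ = λ f g → ∀ a → proj₁ (to f a) ≡ proj₁ (to g a)
    ; id = λ {A} → Ident.surjection (Elements A)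
    ; _∘_ = λ g f → Comp.surjection f g
    ; equiv = record
      { refl = λ a → ≡.refl
      ; sym = λ p a → ≡.sym (p a)
      ; trans = λ p q a → ≡.trans (p a) (q a)
      }
    ; ∘-resp-≈ = λ {A} {B} {C} {f} {h} {g} {i} p q a → ≡.trans (Surjection.cong f (q a)) (p (to i a))
    ; identityˡ = λ a → ≡.refl
    ; identityʳ = λ a → ≡.refl
    ; assoc = λ a → ≡.refl
    }
    where open Surjection using (to)

  [𝕊,Set] : ∀ ℓ → Category (Level.suc ℓ) (Level.suc ℓ) ℓ
  [𝕊,Set] ℓ = functorCategory 𝕊 (Sets ℓ)

  restrict : (ρ : Renaming) (A : FinSubset) → Category._⇒_ 𝕊 A (map (Renaming.apply ρ) A)
  restrict ρ A = record
    { to = λ (a , a∈A) → apply a , ∈-map⁺ apply a∈A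
    ; cong = cong apply
    ; surjective = λ (b , b∈) → let (a , a∈A , b≡) = ∈-map⁻ apply b∈ in
        (a , a∈A) , λ z≡a → ≡.trans (cong apply z≡a) (≡.sym b≡)
    }
    where open Renaming ρ

  -- The identity A ↠ B for lists A, B denoting the same subset.
  relabel : ∀ {A B} → A ≐ B → Category._⇒_ 𝕊 A B
  relabel (A⊆B , B⊆A) = record
    { to = λ (a , a∈A) → a , A⊆B a∈A
    ; cong = idᶠ
    ; surjective = λ (b , b∈B) → (b , B⊆A b∈B) , idᶠ
    }

  module _ {ℓ : Level} where

    private
      module 𝕊 = Category 𝕊
      module Sets = Category (Sets ℓ)

    module _ (F : Functor 𝕊 (Sets ℓ)) where

      open Functor F

      private
        module _ {A : FinSubset} where
          open Setoid (F₀ A) public using () renaming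
            (_≈_ to infix 4 _≈_; refl to ≈-refl; sym to ≈-sym; trans to ≈-trans)

        infixr 7 _▹_
        _▹_ : ∀ {A B} → A 𝕊.⇒ B → Setoid.Carrier (F₀ A) → Setoid.Carrier (F₀ B)
        f ▹ x = Func.to (F₁ f) x

        ▹-cong : ∀ {A B} (f : A 𝕊.⇒ B) {x y} → x ≈ y → f ▹ x ≈ f ▹ y
        ▹-cong f = Func.cong (F₁ f)

        ▹-id : ∀ {A} (f : A 𝕊.⇒ A) → f 𝕊.≈ 𝕊.id → ∀ x → f ▹ x ≈ x
        ▹-id f f≈id x = ≈-trans (F-resp-≈ {f = f} {𝕊.id} f≈id x) (identity x)

        ▹-∘ : ∀ {A B C} (f : A 𝕊.⇒ B) (g : B 𝕊.⇒ C) (h : A 𝕊.⇒ C) →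
              g 𝕊.∘ f 𝕊.≈ h → ∀ x → g ▹ f ▹ x ≈ h ▹ x
        ▹-∘ f g h gf≈h x = ≈-trans (≈-sym (homomorphism {f = f} {g} x)) (F-resp-≈ {f = g 𝕊.∘ f} {h} gf≈h x)

        ▹-square : ∀ {A B C D} (f : A 𝕊.⇒ B) (g : B 𝕊.⇒ D) (h : A 𝕊.⇒ C) (k : C 𝕊.⇒ D) →
                   g 𝕊.∘ f 𝕊.≈ k 𝕊.∘ h → ∀ x → g ▹ f ▹ x ≈ k ▹ h ▹ x
        ▹-square f g h k p x = ≈-trans (▹-∘ f g (k 𝕊.∘ h) p x) (homomorphism {f = h} {k} x)

      ∐-setoid : Setoid ℓ ℓ
      ∐-setoid = record
        { Carrier = Σ FinSubset λ A → Setoid.Carrier (F₀ A)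
        ; _≈_ = λ (A , x) (B , y) → Σ[ A≐B ∈ A ≐ B ] relabel A≐B ▹ x ≈ y
        ; isEquivalence = record
          { refl = λ {(A , x)} → ≐-refl , ▹-id (relabel ≐-refl) (λ a → ≡.refl) x
          ; sym = λ {(A , x)} {(B , y)} (A≐B , p) → ≐-sym A≐B ,
              ≈-trans (▹-cong (relabel (≐-sym A≐B)) (≈-sym p))
                (≈-trans (▹-∘ (relabel A≐B) (relabel (≐-sym A≐B)) 𝕊.id (λ a → ≡.refl) x)
                         (▹-id 𝕊.id (λ a → ≡.refl) x))
          ; trans = λ {(A , x)} {(B , y)} {(C , z)} (A≐B , p) (B≐C , q) → ≐-trans A≐B B≐C ,
              ≈-trans (≈-sym (▹-∘ (relabel A≐B) (relabel B≐C) (relabel (≐-trans A≐B B≐C)) (λ a → ≡.refl) x))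
                (≈-trans (▹-cong (relabel B≐C) p) q)
          }
        }

      private module ∐ = Setoid ∐-setoid

      ∐-action : Renaming → ∐.Carrier → ∐.Carrier
      ∐-action ρ (A , x) = map (Renaming.apply ρ) A , restrict ρ A ▹ x

      ∐-supports : ∀ ((A , x) : ∐.Carrier) ρ → (∀ {a} → a ∈ A → ρ ⟨ a ⟩ ≡ a) →
                   ∐-action ρ (A , x) ∐.≈ (A , x)
      ∐-supports (A , x) ρ fixes = eq , ≈-trans
          (▹-∘ (restrict ρ A) (relabel eq) 𝕊.id (λ (a , a∈A) → fixes a∈A) x)
          (▹-id 𝕊.id (λ a → ≡.refl) x)
        where
        eq : map (Renaming.apply ρ) A ≐ A
        eq = map-id-≐ fixes

      ∐-renamingSet : RenamingSet ℓ
      ∐-renamingSet = record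
        { setoid = ∐-setoid
        ; _·_ = ∐-action
        ; ·-cong = λ {ρ} {σ} {(A , x)} {(B , y)} ρ≈σ (A≐B , p) →
            let eq = map-≐ (λ {a} _ → ρ≈σ a) A≐B in
            eq , ≈-trans
              (▹-square (restrict ρ A) (relabel eq) (relabel A≐B) (restrict σ B) (λ (a , _) → ρ≈σ a) x)
              (▹-cong (restrict σ B) p)
        ; ·-ε = λ (A , x) → ∐-supports (A , x) (Monoid.ε RenMonoid) (λ _ → ≡.refl)
        ; ·-∙ = λ ρ σ (A , x) →
            let eq = map-∘-≐ (Renaming.apply ρ) (Renaming.apply σ) in
            eq , ▹-square (restrict (ρ ∙ σ) A) (relabel eq) (restrict σ A)
                   (restrict ρ (map (Renaming.apply σ) A)) (λ a → ≡.refl) x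
        ; finitelySupported = λ (A , x) → A , ∐-supports (A , x) , λ B B-supports →
            invariant⇒⊆ A B λ π fixes → proj₂ (proj₁ (B-supports (toRenaming π) fixes))
        }
        where open Monoid RenMonoid using (_∙_)

      ∐₀ : RelevanceSet ℓ
      ∐₀ = record { renamingSet = ∐-renamingSet ; relevant = λ ρ x → ≐-refl }

    ∐₁ : ∀ {F G} → NaturalTransformation F G →
         Ren.SuppPreservingMap (∐-renamingSet F) (∐-renamingSet G)
    ∐₁ {F} {G} α = record
      { equivariantMap = record
        { func = record
          { to = λ (A , x) → A , Func.to (η A) x
          ; cong = λ {(A , x)} {(B , y)} (A≐B , p) → A≐B ,
              Setoid.trans (Functor.F₀ G B)
                (Setoid.sym (Functor.F₀ G B) (natural (relabel A≐B) x))
                (Func.cong (η B) p)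
          }
        ; equivariant = λ ρ (A , x) →
            let ρA = map (Renaming.apply ρ) A
                open Setoid (Functor.F₀ G ρA) in
            ≐-refl , trans (Functor.F-resp-≈ G {f = relabel ≐-refl} {𝕊.id} (λ a → ≡.refl) _)
                       (trans (Functor.identity G _) (natural (restrict ρ A) x))
        }
      ; supp-preserving = λ x → ≐-refl
      }
      where open NaturalTransformation α

  ∐ : ∀ ℓ → Functor ([𝕊,Set] ℓ) (Relev₌ ℓ)
  ∐ ℓ = record
    { F₀ = ∐₀
    ; F₁ = ∐₁
    ; F-resp-≈ = λ {F} {G} {α} {β} α≈β (A , x) → ≐-refl ,
        Setoid.trans (Functor.F₀ G A) (identity′ G _) (α≈β A x)
    ; identity = λ {F} x → Setoid.refl (∐-setoid F) {x}
    ; homomorphism = λ {F} {G} {H} x → Setoid.refl (∐-setoid H)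
    }
    where
    identity′ : ∀ (G : Functor 𝕊 (Sets ℓ)) {A} (y : Setoid.Carrier (Functor.F₀ G A)) →
                Setoid._≈_ (Functor.F₀ G A) (Func.to (Functor.F₁ G (relabel ≐-refl)) y) y
    identity′ G {A} y = Setoid.trans (Functor.F₀ G A)
      (Functor.F-resp-≈ G {f = relabel ≐-refl} {Category.id 𝕊} (λ a → ≡.refl) y) (Functor.identity G y)

  -- ρ · x depends only on the restriction of ρ to a support of x.
  ·-determined : ∀ {ℓ} (X : RenamingSet ℓ) → let open Ren.FSSet X in
                 ∀ {A x} → Supports A x →
                 ∀ ρ σ → (∀ {a} → a ∈ A → ρ ⟨ a ⟩ ≡ σ ⟨ a ⟩) → ρ · x ≈ σ · x
  ·-determined X {A} {x} A-supports ρ σ agree = begin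
    ρ · x         ≈⟨ ·-cong (λ a → ≡.refl) (A-supports θ θ-fixes) ⟨
    ρ · θ · x     ≈⟨ ·-∙ ρ θ x ⟨
    (ρ ∙ θ) · x   ≈⟨ ·-cong {ρ ∙ θ} {σ ∙ θ} ρθ≡σθ refl ⟩
    (σ ∙ θ) · x   ≈⟨ ·-∙ σ θ x ⟩
    σ · θ · x     ≈⟨ ·-cong (λ a → ≡.refl) (A-supports θ θ-fixes) ⟩
    σ · x         ∎
    where
    open Ren.FSSet X
    open Monoid RenMonoid using (_∙_)
    open SetoidReasoning setoid
    movedBoth : FinSubset
    movedBoth = Renaming.moved ρ ++ Renaming.moved σ
    c : 𝔸
    c = fresh movedBoth
    ρ-fixed : ∀ {a} → a ∉ movedBoth → ρ ⟨ a ⟩ ≡ a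
    ρ-fixed a∉ = Renaming.fixed ρ (λ a∈ → a∉ (∈-++⁺ˡ a∈))
    σ-fixed : ∀ {a} → a ∉ movedBoth → σ ⟨ a ⟩ ≡ a
    σ-fixed a∉ = Renaming.fixed σ (λ a∈ → a∉ (∈-++⁺ʳ (Renaming.moved ρ) a∈))
    collapse : 𝔸 → 𝔸
    collapse a with a ∈? A | a ∈? movedBoth
    ... | yes _ | _     = a
    ... | no _  | yes _ = c
    ... | no _  | no _  = a
    collapse-fixed : ∀ {a} → a ∉ movedBoth → collapse a ≡ a
    collapse-fixed {a} a∉ with a ∈? A | a ∈? movedBoth
    ... | yes _ | _     = ≡.refl
    ... | no _  | yes p = contradiction p a∉
    ... | no _  | no _  = ≡.refl
    θ : Renaming
    θ = record { apply = collapse ; moved = movedBoth ; fixed = collapse-fixed }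
    θ-fixes : ∀ {a} → a ∈ A → θ ⟨ a ⟩ ≡ a
    θ-fixes {a} a∈A with a ∈? A | a ∈? movedBoth
    ... | yes _ | _ = ≡.refl
    ... | no ¬p | _ = contradiction a∈A ¬p
    ρθ≡σθ : ∀ a → ρ ⟨ collapse a ⟩ ≡ σ ⟨ collapse a ⟩
    ρθ≡σθ a with a ∈? A | a ∈? movedBoth
    ... | yes p | _     = agree p
    ... | no _  | yes _ = ≡.trans (ρ-fixed (fresh∉ movedBoth)) (≡.sym (σ-fixed (fresh∉ movedBoth)))
    ... | no _  | no ¬q = ≡.trans (ρ-fixed ¬q) (≡.sym (σ-fixed ¬q))

  Extends : ∀ {A B} → Renaming → Category._⇒_ 𝕊 A B → Set
  Extends {A} ρ f = ∀ {a} (a∈A : a ∈ A) → ρ ⟨ a ⟩ ≡ proj₁ (Surjection.to f (a , a∈A))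

  extend : ∀ {A B} → Category._⇒_ 𝕊 A B → Renaming
  extend {A} f = record { apply = apply ; moved = A ; fixed = fixed }
    where
    apply : 𝔸 → 𝔸
    apply a with a ∈? A
    ... | yes a∈A = proj₁ (Surjection.to f (a , a∈A))
    ... | no _    = a
    fixed : ∀ {a} → a ∉ A → apply a ≡ a
    fixed {a} a∉A with a ∈? A
    ... | yes a∈A = contradiction a∈A a∉A
    ... | no _    = ≡.refl

  extend-extends : ∀ {A B} (f : Category._⇒_ 𝕊 A B) → Extends (extend f) f
  extend-extends {A} f {a} a∈A with a ∈? A
  ... | yes p = Surjection.cong f {a , p} {a , a∈A} ≡.refl
  ... | no ¬p = contradiction a∈A ¬p

  map-extension : ∀ {A B} (f : Category._⇒_ 𝕊 A B) ρ → Extends ρ f → map (Renaming.apply ρ) A ≐ B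
  map-extension {A} {B} f ρ ext = to , from
    where
    to : map (Renaming.apply ρ) A ⊆ B
    to b∈ with ∈-map⁻ (Renaming.apply ρ) b∈
    ... | a , a∈A , ≡.refl = ≡.subst (_∈ B) (≡.sym (ext a∈A)) (proj₂ (Surjection.to f (a , a∈A)))
    from : B ⊆ map (Renaming.apply ρ) A
    from {b} b∈B = let ((a , a∈A) , fa≡b) = Surjection.surjective f (b , b∈B) in
      ≡.subst (_∈ map (Renaming.apply ρ) A) (≡.trans (ext a∈A) (fa≡b ≡.refl)) (∈-map⁺ (Renaming.apply ρ) a∈A)

  module _ {ℓ : Level} (X : RelevanceSet ℓ) where

    open RelevanceSet X hiding (renamingSet)
    private module 𝕊 = Category 𝕊

    𝒮-setoid : FinSubset → Setoid ℓ ℓ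
    𝒮-setoid A = On.setoid {B = Σ[ x ∈ Carrier ] supp x ≐ A} setoid proj₁

    𝒮-func : ∀ {A B} → A 𝕊.⇒ B → Func (𝒮-setoid A) (𝒮-setoid B)
    𝒮-func f = record
      { to = λ (x , x≐A) → extend f · x ,
          ≐-trans (≐-sym (relevant (extend f) x))
            (≐-trans (map-≐ (λ _ → ≡.refl) x≐A) (map-extension f (extend f) (extend-extends f)))
      ; cong = ·-cong (λ a → ≡.refl)
      }

    𝒮-supports : ∀ {A} ((x , _) : Setoid.Carrier (𝒮-setoid A)) → Supports A x
    𝒮-supports (x , (x⊆A , _)) ρ fixes = supp-supports x ρ (λ a∈ → fixes (x⊆A a∈))

    -- The choice of extension is immaterial.
    𝒮-func-any : ∀ {A B} (f : A 𝕊.⇒ B) ρ → Extends ρ f →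
                 ∀ x → proj₁ (Func.to (𝒮-func f) x) ≈ ρ · proj₁ x
    𝒮-func-any f ρ ext x = ·-determined (renamingSet X) (𝒮-supports x) (extend f) ρ
      (λ a∈A → ≡.trans (extend-extends f a∈A) (≡.sym (ext a∈A)))

    𝒮₀ : Functor 𝕊 (Sets ℓ)
    𝒮₀ = record
      { F₀ = 𝒮-setoid
      ; F₁ = 𝒮-func
      ; F-resp-≈ = λ {A} {B} {f} {g} f≈g x →
          𝒮-func-any f (extend g) (λ a∈A → ≡.trans (extend-extends g a∈A) (≡.sym (f≈g (_ , a∈A)))) x
      ; identity = λ {A} x →
          𝒮-supports x (extend (𝕊.id {A})) (extend-extends (𝕊.id {A}))
      ; homomorphism = λ {A} {B} {C} {f} {g} x → trans
          (𝒮-func-any (g 𝕊.∘ f) (extend g ∙ extend f)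
            (λ a∈A → ≡.trans
              (cong (Renaming.apply (extend g)) (extend-extends f a∈A))
              (extend-extends g (proj₂ (Surjection.to f (_ , a∈A))))) x)
          (·-∙ (extend g) (extend f) (proj₁ x))
      }
      where open Monoid RenMonoid using (_∙_)

  𝒮 : ∀ ℓ → Functor (Relev₌ ℓ) ([𝕊,Set] ℓ)
  𝒮 ℓ = record
    { F₀ = 𝒮₀
    ; F₁ = λ {X} {Y} f → record
      { η = λ A → record
        { to = λ (x , x≐A) → to f x , ≐-trans (supp-preserving f x) x≐A
        ; cong = to-cong f
        }
      ; natural = λ g (x , _) → equivariant f (extend g) x
      }
    ; F-resp-≈ = λ f≈g A (x , _) → f≈g x
    ; identity = λ {X} A x → RelevanceSet.refl X
    ; homomorphism = λ {X} {Y} {Z} A x → RelevanceSet.refl Z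
    }
    where open Ren.SuppPreservingMap

  supp-equivariant : ∀ {ℓ} (X : NominalSet ℓ) → let open Perm.FSSet X in ∀ π x →
                     map (Permutation.to π) (supp x) ≐ supp (π · x)
  supp-equivariant X π x = from , to π x
    where
    open Perm.FSSet X
    open Group PermGroup using (_⁻¹; _∙_; inverseˡ)
    open Permutation using (strictlyInverseˡ; strictlyInverseʳ) renaming (to to app)

    cancel : ∀ σ y → (σ ⁻¹) · σ · y ≈ y
    cancel σ y = trans (sym (·-∙ (σ ⁻¹) σ y)) (trans (·-cong (inverseˡ σ) refl) (·-ε y))

    to : ∀ σ y → supp (σ · y) ⊆ map (app σ) (supp y)
    to σ y = supp-least (σ · y) λ τ fixes → begin
      τ · σ · y                      ≈⟨ cancel (σ ⁻¹) (τ · σ · y) ⟨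
      ((σ ⁻¹) ⁻¹) · (σ ⁻¹) · τ · σ · y ≈⟨ ·-cong (λ a → ≡.refl) (·-cong (λ a → ≡.refl) (·-∙ τ σ y)) ⟨
      σ · (σ ⁻¹) · (τ ∙ σ) · y       ≈⟨ ·-cong (λ a → ≡.refl) (·-∙ (σ ⁻¹) (τ ∙ σ) y) ⟨
      σ · ((σ ⁻¹) ∙ (τ ∙ σ)) · y     ≈⟨ ·-cong (λ a → ≡.refl) (supp-supports y _ (λ {a} a∈ →
                                          ≡.trans (cong (app (σ ⁻¹)) (fixes (∈-map⁺ (app σ) a∈)))
                                                  (strictlyInverseʳ σ a))) ⟩
      σ · y                          ∎
      where open SetoidReasoning setoid

    from : map (app π) (supp x) ⊆ supp (π · x)
    from b∈ with ∈-map⁻ (app π) b∈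
    ... | a , a∈ , ≡.refl with ∈-map⁻ (app (π ⁻¹))
                                 (to (π ⁻¹) (π · x) (proj₂ (supp-cong (cancel π x)) a∈))
    ... | b , b∈′ , ≡.refl = ≡.subst (_∈ supp (π · x)) (≡.sym (strictlyInverseˡ π b)) b∈′

  𝒯₀ : ∀ {ℓ} → NominalSet ℓ → NominalSet ℓ
  𝒯₀ X = record
    { setoid = record
      { Carrier = Σ[ (x , A) ∈ Carrier × FinSubset ] supp x ⊆ A
      ; _≈_ = λ ((x , A) , _) ((y , B) , _) → x ≈ y × A ≐ B
      ; isEquivalence = record
        { refl = refl , ≐-refl
        ; sym = λ (p , q) → sym p , ≐-sym q
        ; trans = λ (p , q) (r , s) → trans p r , ≐-trans q s
        }
      }
    ; _·_ = λ π ((x , A) , x⊆A) →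
        (π · x , map (to π) A) ,
        λ a∈ → map-⊆ (λ _ → ≡.refl) x⊆A (proj₂ (supp-equivariant X π x) a∈)
    ; ·-cong = λ π≈σ (p , q) → ·-cong π≈σ p , map-≐ (λ {a} _ → π≈σ a) q
    ; ·-ε = λ ((x , A) , _) → ·-ε x , map-id-≐ (λ _ → ≡.refl)
    ; ·-∙ = λ π σ ((x , A) , _) → ·-∙ π σ x , map-∘-≐ (to π) (to σ)
    ; finitelySupported = λ ((x , A) , x⊆A) →
        A
      , (λ π fixes → supp-supports x π (λ a∈ → fixes (x⊆A a∈)) , map-id-≐ fixes)
      , (λ B B-supports → invariant⇒⊆ A B λ π fixes → proj₂ (proj₂ (B-supports π fixes)))
    }
    where
    open Perm.FSSet X
    open Permutation using (to)

  𝒯 : ∀ ℓ → Monad (Nom₌ ℓ)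
  𝒯 ℓ = record
    { T = record
      { F₀ = 𝒯₀
      ; F₁ = λ f → record
        { equivariantMap = record
          { func = record
            { to = λ ((x , A) , x⊆A) →
                (to f x , A) , λ a∈ → x⊆A (proj₁ (supp-preserving f x) a∈)
            ; cong = λ (p , q) → to-cong f p , q
            }
          ; equivariant = λ π ((x , A) , _) → equivariant f π x , ≐-refl
          }
        ; supp-preserving = λ _ → ≐-refl
        }
      ; F-resp-≈ = λ f≈g ((x , A) , _) → f≈g x , ≐-refl
      ; identity = λ {X} _ → Perm.FSSet.refl X , ≐-refl
      ; homomorphism = λ {X} {Y} {Z} _ → Perm.FSSet.refl Z , ≐-refl
      }
    ; unit = record
      { η = λ X → let open Perm.FSSet X in record
        { equivariantMap = record
          { func = record
            { to = λ x → (x , supp x) , idᶠ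
            ; cong = λ x≈y → x≈y , supp-cong x≈y
            }
          ; equivariant = λ π x → refl , ≐-sym (supp-equivariant X π x)
          }
        ; supp-preserving = λ x → ≐-refl
        }
      ; natural = λ {X} {Y} f x → Perm.FSSet.refl Y , supp-preserving f x
      }
    ; mult = record
      { η = λ X → record
        { equivariantMap = record
          { func = record
            { to = λ ((((x , A) , x⊆A) , B) , A⊆B) → (x , B) , λ a∈ → A⊆B (x⊆A a∈)
            ; cong = λ ((p , _) , q) → p , q
            }
          ; equivariant = λ π _ → Perm.FSSet.refl X , ≐-refl
          }
        ; supp-preserving = λ _ → ≐-refl
        }
      ; natural = λ {X} {Y} f _ → Perm.FSSet.refl Y , ≐-refl
      }
    ; μ-assoc = λ {X} _ → Perm.FSSet.refl X , ≐-refl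
    ; μ-identityˡ = λ {X} _ → Perm.FSSet.refl X , ≐-refl
    ; μ-identityʳ = λ {X} _ → Perm.FSSet.refl X , ≐-refl
    }
    where open Perm.SuppPreservingMap

  castFunc : ∀ {ℓ} {S T : Setoid ℓ ℓ} → S ≡ T → Func S T
  castFunc {S = S} ≡.refl = Ident.function S

  -- Equality of nominal sets: the same underlying set with the same action.
  -- This determines supports, so no further condition is needed.
  record _≡Nom_ {ℓ} (X Y : NominalSet ℓ) : Set (Level.suc ℓ) where
    private
      module X = Perm.FSSet X
      module Y = Perm.FSSet Y
    field
      setoid≡ : X.setoid ≡ Y.setoid

    open Func (castFunc setoid≡) using () renaming (to to cast; cong to cast-cong)

    field
      action≡ : ∀ π x → cast (π X.· x) Y.≈ π Y.· cast x

    -- The identity map of the common underlying set.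
    castMap : Perm.SuppPreservingMap X Y
    castMap = record
      { equivariantMap = record { func = castFunc setoid≡ ; equivariant = action≡ }
      ; supp-preserving = λ x →
            (λ {a} → Y.supp-least (cast x) (λ π fixes →
              Y.trans (Y.sym (action≡ π x)) (cast-cong (X.supp-supports x π fixes))))
          , (λ {a} → X.supp-least x (λ π fixes →
              cast-injective setoid≡
                (Y.trans (action≡ π x) (Y.supp-supports (cast x) π fixes))))
      }
      where
      cast-injective : ∀ {S T : Setoid ℓ ℓ} (S≡T : S ≡ T) {x y} →
        Setoid._≈_ T (Func.to (castFunc S≡T) x) (Func.to (castFunc S≡T) y) → Setoid._≈_ S x y
      cast-injective ≡.refl p = p

  -- forget T̄ = T forget, forget η̄ = η forget and forget μ̄ = μ forget, where the
  -- two sides of each equation are compared along the identity maps castMap.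
  record IsLifting {ℓ} (T : Monad (Nom₌ ℓ)) (T̄ : Monad (Relev₌ ℓ)) : Set (Level.suc ℓ) where
    private
      module T = Monad T
      module T̄ = Monad T̄
      module U = Functor (forget ℓ)
      open Category (Nom₌ ℓ)
      open Category (Relev₌ ℓ) using () renaming (Obj to Objʳ; _⇒_ to _⇒ʳ_)
    field
      object : (X : Objʳ) → U.F₀ (T̄.T₀ X) ≡Nom T.T₀ (U.F₀ X)

    cast : (X : Objʳ) → U.F₀ (T̄.T₀ X) ⇒ T.T₀ (U.F₀ X)
    cast X = _≡Nom_.castMap (object X)

    field
      morphism : ∀ {X Y} (f : X ⇒ʳ Y) →
                 cast Y ∘ U.F₁ {T̄.T₀ X} {T̄.T₀ Y} (T̄.T₁ f) ≈ T.T₁ (U.F₁ {X} {Y} f) ∘ cast X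
      unit     : ∀ X → cast X ∘ U.F₁ {X} {T̄.T₀ X} (T̄.η X) ≈ T.η (U.F₀ X)
      mult     : ∀ X → cast X ∘ U.F₁ {T̄.T₀ (T̄.T₀ X)} {T̄.T₀ X} (T̄.μ X) ≈
                       T.μ (U.F₀ X) ∘ (T.T₁ (cast X) ∘ cast (T̄.T₀ X))

{-# OPTIONS --safe #-}

-- An element of ∐(𝒮 X) is an element x of X tagged with its support, so it carries
-- the same information as x; conversely an element of 𝒮(∐ F)(A) is some κ_B(y) with
-- B = A, which is transported back to F A along the identity of B and A.
--
-- An equivariant map f between relevance sets satisfies supp (f x) ⊆ supp x, and it
-- becomes support-preserving once its values are padded to x ↦ (f x , supp x). A
-- support-preserving map into 𝒯̄ Y must have this second component, so it is
-- determined by the first one.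
module Submission where

open import Data.List.Base using (map)
open import Data.Nat.Base using (ℕ)
open import Data.Product.Base using (_×_; _,_; proj₁; proj₂; ∃-syntax)
open import Function.Base using () renaming (id to idᶠ)
open import Function.Bundles using (_↔_; Func)
open import Level using (Level)
open import Relation.Binary.Bundles using (Setoid)
open import Relation.Binary.PropositionalEquality.Core using (refl; sym)
open import Defs

module RelevanceSets (𝔸 : Set) (𝔸↔ℕ : 𝔸 ↔ ℕ) (ℓ : Level) where

  open Names 𝔸 𝔸↔ℕ
  open Renaming using (apply)

  private module 𝕊 = Category 𝕊

  -- The unit: a presheaf `F` against `𝒮 (∐ F)`.

  module Presheaf (F : Functor 𝕊 (Sets ℓ)) where
    open Functor F public

    module _ {A : FinSubset} where
      open Setoid (F₀ A) public using (_≈_)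
        renaming (sym to ≈-sym; trans to ≈-trans)

    infixr 7 _▹_
    _▹_ : ∀ {A B} → A 𝕊.⇒ B → Setoid.Carrier (F₀ A) → Setoid.Carrier (F₀ B)
    f ▹ x = Func.to (F₁ f) x

    ▹-id : ∀ {A} (f : A 𝕊.⇒ A) → f 𝕊.≈ 𝕊.id → ∀ x → f ▹ x ≈ x
    ▹-id f f≈id x = ≈-trans (F-resp-≈ {f = f} {𝕊.id} f≈id x) (identity x)

    ▹-∘ : ∀ {A B C} (f : A 𝕊.⇒ B) (g : B 𝕊.⇒ C) (h : A 𝕊.⇒ C) →
          g 𝕊.∘ f 𝕊.≈ h → ∀ x → g ▹ f ▹ x ≈ h ▹ x
    ▹-∘ f g h gf≈h x =
      ≈-trans (≈-sym (homomorphism {f = f} {g} x)) (F-resp-≈ {f = g 𝕊.∘ f} {h} gf≈h x)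

    ▹-square : ∀ {A B C D} (f : A 𝕊.⇒ B) (g : B 𝕊.⇒ D) (h : A 𝕊.⇒ C) (k : C 𝕊.⇒ D) →
               g 𝕊.∘ f 𝕊.≈ k 𝕊.∘ h → ∀ x → g ▹ f ▹ x ≈ k ▹ h ▹ x
    ▹-square f g h k p x = ≈-trans (▹-∘ f g (k 𝕊.∘ h) p x) (homomorphism {f = h} {k} x)

  -- The coproduct injections; they land in `𝒮 (∐ F)` because the support of `(A , x)` in `∐ F` is
  -- its tag `A`.
  κ : (F : Functor 𝕊 (Sets ℓ)) → NaturalTransformation F (𝒮₀ (∐₀ F))
  κ F = record
    { η = λ A → record
      { to = λ x → (A , x) , ≐-refl
      ; cong = λ x≈y → ≐-refl , ≈-trans (▹-id (relabel ≐-refl) (λ _ → refl) _) x≈y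
      }
    ; natural = λ {A} {B} f x →
        -- Acting on `(A , x)` produces the tag `map (apply (extend f)) A`, which has the elements
        -- of `B` but may be another list.
        let ρA≐B = map-extension f (extend f) (extend-extends f) in
        ≐-sym ρA≐B ,
        ▹-∘ f (relabel (≐-sym ρA≐B)) (restrict (extend f) A)
          (λ (a , a∈A) → sym (extend-extends f a∈A)) x
    }
    where open Presheaf F

  -- An element of support `A` carries a tag `B` equal to `A` only as a set, so `x` reaches `F A` by
  -- transport along `relabel`.
  κ⁻¹ : (F : Functor 𝕊 (Sets ℓ)) → NaturalTransformation (𝒮₀ (∐₀ F)) F
  κ⁻¹ F = record
    { η = λ A → record
      { to = λ ((B , x) , B≐A) → relabel B≐A ▹ x
      ; cong = λ {((B , x) , B≐A)} {((C , y) , C≐A)} (B≐C , p) →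
          ≈-trans
            (≈-sym (▹-∘ (relabel B≐C) (relabel C≐A) (relabel B≐A) (λ _ → refl) x))
            (Func.cong (F₁ (relabel C≐A)) p)
      }
    ; natural = λ {A} {A′} f ((B , x) , B≐A@(B⊆A , _)) →
        -- Both paths from `B` to `A′` act on names as `f`, since `extend f` agrees with `f` on `A`,
        -- which contains `B`.
        ▹-square (restrict (extend f) B) (relabel _) (relabel B≐A) f
          (λ (b , b∈B) → extend-extends f (B⊆A b∈B)) x
    }
    where open Presheaf F

  κ-iso : NaturalIsomorphism (idF ([𝕊,Set] ℓ)) (𝒮 ℓ ∘F ∐ ℓ)
  κ-iso = record
    { to = record
      { η = κ
      ; natural = λ {F} {G} α A x → Setoid.refl (∐-setoid G)
      }
    ; from = record
      { η = κ⁻¹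
      ; natural = λ {F} {G} α A ((B , x) , B≐A) →
          Setoid.sym (Functor.F₀ G A) (NaturalTransformation.natural α (relabel B≐A) x)
      }
    ; to∘from = λ F A ((B , x) , B≐A) → let open Presheaf F in
        ≐-sym B≐A ,
        ≈-trans (▹-∘ (relabel B≐A) (relabel (≐-sym B≐A)) 𝕊.id (λ _ → refl) x)
                (identity x)
    ; from∘to = λ F A x → let open Presheaf F in ▹-id (relabel ≐-refl) (λ _ → refl) x
    }

  -- The counit: `∐ (𝒮 X)` against `X`.

  relabel-fixes : ∀ (X : RelevanceSet ℓ) {A B} (A≐B : A ≐ B) (x : Setoid.Carrier (𝒮-setoid X A)) →
                  RelevanceSet._≈_ X (proj₁ (Func.to (𝒮-func X (relabel A≐B)) x)) (proj₁ x)
  -- The extension of `relabel A≐B` fixes every name in `A`, and `A` supports `x`. Hence elements of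
  -- `∐ (𝒮 X)` with equal tags are compared as in `X`.
  relabel-fixes X A≐B x = 𝒮-supports X x _ (extend-extends (relabel A≐B))

  module _ (X : RelevanceSet ℓ) where
    open RelevanceSet X hiding (renamingSet; refl; sym)
    private module X = RelevanceSet X

    ∐𝒮-to : Category._⇒_ (Relev₌ ℓ) (Functor.F₀ (∐ ℓ ∘F 𝒮 ℓ) X) X
    ∐𝒮-to = record
      { equivariantMap = record
        { func = record
          { to = λ (A , (x , _)) → x
          ; cong = λ {(A , x)} {(B , y)} (A≐B , p) →
              trans (X.sym (relabel-fixes X A≐B x)) p
          }
        ; equivariant = λ ρ (A , x) →
            -- `ρ` itself extends `restrict ρ A`, so it may replace the chosen extension.
            𝒮-func-any X (restrict ρ A) ρ (λ _ → refl) x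
        }
      ; supp-preserving = λ (A , (x , x≐A)) → x≐A
      }

    ∐𝒮-from : Category._⇒_ (Relev₌ ℓ) X (Functor.F₀ (∐ ℓ ∘F 𝒮 ℓ) X)
    ∐𝒮-from = record
      { equivariantMap = record
        { func = record
          { to = λ x → supp x , (x , ≐-refl)
          ; cong = λ {x} {y} x≈y →
              let x≐y = supp-cong x≈y in
              x≐y , trans (relabel-fixes X x≐y (x , ≐-refl)) x≈y
          }
        ; equivariant = λ ρ x →
            -- Relevance identifies the tag `supp (ρ · x)` with the image of `supp x` under `ρ`.
            let ρx≐ = ≐-sym (relevant ρ x) in
            ρx≐ ,
            trans (relabel-fixes X ρx≐ (ρ · x , ≐-refl))
              (X.sym (𝒮-func-any X (restrict ρ (supp x)) ρ (λ _ → refl) (x , ≐-refl)))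
        }
      ; supp-preserving = λ x → ≐-refl
      }

  ∐𝒮-iso : NaturalIsomorphism (∐ ℓ ∘F 𝒮 ℓ) (idF (Relev₌ ℓ))
  ∐𝒮-iso = record
    { to = record
      { η = ∐𝒮-to
      ; natural = λ {X} {Y} f _ → RelevanceSet.refl Y
      }
    ; from = record
      { η = ∐𝒮-from
      ; natural = λ {X} {Y} f x → let open Ren.SuppPreservingMap f in
          supp-preserving x , relabel-fixes Y (supp-preserving x) (to x , ≐-refl)
      }
    ; to∘from = λ X x → RelevanceSet.refl X
    ; from∘to = λ X (A , (x , x≐A)) → x≐A , relabel-fixes X x≐A (x , ≐-refl)
    }

  ∐𝒮-equivalence : IsCategoryEquivalence (∐ ℓ) (𝒮 ℓ)
  ∐𝒮-equivalence = record { unit = κ-iso ; counit = ∐𝒮-iso }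

  -- The lifted monad.

  𝒯̄₀ : RelevanceSet ℓ → RelevanceSet ℓ
  𝒯̄₀ X = record
    { renamingSet = record
      -- Sharing the setoid of `𝒯₀` makes the casts in `IsLifting` identities, so the lifting
      -- equations hold by reflexivity.
      { setoid = Perm.FSSet.setoid (𝒯₀ (restrictAction X))
      ; _·_ = λ ρ ((x , A) , x⊆A) →
          (ρ · x , map (apply ρ) A) ,
          λ a∈ → map-⊆ (λ _ → refl) x⊆A (proj₂ (relevant ρ x) a∈)
      ; ·-cong = λ ρ≈σ (p , q) → ·-cong ρ≈σ p , map-≐ (λ {a} _ → ρ≈σ a) q
      ; ·-ε = λ ((x , A) , _) → ·-ε x , map-id-≐ (λ _ → refl)
      ; ·-∙ = λ ρ σ ((x , A) , _) → ·-∙ ρ σ x , map-∘-≐ (apply ρ) (apply σ)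
      ; finitelySupported = λ ((x , A) , x⊆A) →
          A
        , (λ ρ fixes → supp-supports x ρ (λ a∈ → fixes (x⊆A a∈)) , map-id-≐ fixes)
        -- Permutations suffice for minimality: if `B` supports the pair, each `π` fixing `B`
        -- preserves its second component `A`.
        , (λ B B-supports → invariant⇒⊆ A B λ π fixes →
             proj₂ (proj₂ (B-supports (toRenaming π) fixes)))
      }
    ; relevant = λ ρ x → ≐-refl
    }
    where open RelevanceSet X hiding (renamingSet; refl; sym)

  𝒯̄ : Monad (Relev₌ ℓ)
  𝒯̄ = record
    { T = record
      { F₀ = 𝒯̄₀
      ; F₁ = λ f → record
        { equivariantMap = record
          { func = record
            { to = λ ((x , A) , x⊆A) →
                (to f x , A) , λ a∈ → x⊆A (proj₁ (supp-preserving f x) a∈)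
            ; cong = λ (p , q) → to-cong f p , q
            }
          ; equivariant = λ ρ ((x , A) , _) → equivariant f ρ x , ≐-refl
          }
        ; supp-preserving = λ _ → ≐-refl
        }
      ; F-resp-≈ = λ f≈g ((x , A) , _) → f≈g x , ≐-refl
      ; identity = λ {X} _ → RelevanceSet.refl X , ≐-refl
      ; homomorphism = λ {X} {Y} {Z} _ → RelevanceSet.refl Z , ≐-refl
      }
    ; unit = record
      { η = λ X →
        let open RelevanceSet X
        in record
        { equivariantMap = record
          { func = record
            { to = λ x → (x , supp x) , idᶠ
            ; cong = λ x≈y → x≈y , supp-cong x≈y
            }
          ; equivariant = λ ρ x → RelevanceSet.refl X , ≐-sym (relevant ρ x)
          }
        ; supp-preserving = λ x → ≐-refl
        }
      -- The second components are `supp (f x)` and `supp x`.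
      ; natural = λ {X} {Y} f x → RelevanceSet.refl Y , supp-preserving f x
      }
    ; mult = record
      { η = λ X → record
        { equivariantMap = record
          { func = record
            { to = λ ((((x , A) , x⊆A) , B) , A⊆B) → (x , B) , λ a∈ → A⊆B (x⊆A a∈)
            ; cong = λ ((p , _) , q) → p , q
            }
          ; equivariant = λ ρ _ → RelevanceSet.refl X , ≐-refl
          }
        ; supp-preserving = λ _ → ≐-refl
        }
      ; natural = λ {X} {Y} f _ → RelevanceSet.refl Y , ≐-refl
      }
    ; μ-assoc = λ {X} _ → RelevanceSet.refl X , ≐-refl
    ; μ-identityˡ = λ {X} _ → RelevanceSet.refl X , ≐-refl
    ; μ-identityʳ = λ {X} _ → RelevanceSet.refl X , ≐-refl
    }
    where open Ren.SuppPreservingMap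

  𝒯̄-lifts-𝒯 : IsLifting (𝒯 ℓ) 𝒯̄
  𝒯̄-lifts-𝒯 = record
    { object = λ X → record
      { setoid≡ = refl
      ; action≡ = λ π _ → RelevanceSet.refl X , ≐-refl
      }
    ; morphism = λ {X} {Y} f _ → RelevanceSet.refl Y , ≐-refl
    ; unit = λ X _ → RelevanceSet.refl X , ≐-refl
    ; mult = λ X _ → RelevanceSet.refl X , ≐-refl
    }

  -- Equivariant maps as Kleisli morphisms.

  toKleisli : Functor (Relev ℓ) (Kleisli 𝒯̄)
  toKleisli = record
    { F₀ = idᶠ
    ; F₁ = λ {X} {Y} f →
        let module X = RelevanceSet X
            module Y = RelevanceSet Y
            open Ren.EquivariantMap f
        in record
        { equivariantMap = record
          { func = record
            { to = λ x → (to x , X.supp x) , supp-⊆ x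
            ; cong = λ x≈y → to-cong x≈y , X.supp-cong x≈y
            }
          ; equivariant = λ ρ x → equivariant ρ x , ≐-sym (X.relevant ρ x)
          }
        ; supp-preserving = λ x → ≐-refl
        }
    ; F-resp-≈ = λ f≈g x → f≈g x , ≐-refl
    ; identity = λ {X} x → RelevanceSet.refl X , ≐-refl
    -- Multiplication keeps the outer set, which is `supp x` on both sides.
    ; homomorphism = λ {X} {Y} {Z} x → RelevanceSet.refl Z , ≐-refl
    }

  fromKleisli : Functor (Kleisli 𝒯̄) (Relev ℓ)
  fromKleisli = record
    { F₀ = idᶠ
    ; F₁ = λ f →
        let open Ren.SuppPreservingMap f
        in record
        { func = record
          { to = λ x → proj₁ (proj₁ (to x))
          ; cong = λ x≈y → proj₁ (to-cong x≈y)
          }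
        ; equivariant = λ ρ x → proj₁ (equivariant ρ x)
        }
    ; F-resp-≈ = λ f≈g x → proj₁ (f≈g x)
    ; identity = λ {X} x → RelevanceSet.refl X
    ; homomorphism = λ {X} {Y} {Z} x → RelevanceSet.refl Z
    }

  Relev≅Kleisli : Relev ℓ ≅Cat Kleisli 𝒯̄
  Relev≅Kleisli = record
    { to = toKleisli
    ; from = fromKleisli
    ; to∘from = record
      { obj≡ = λ X → refl
      ; mor≡ = λ {X} {Y} f x →
          -- The support of a pair in `𝒯̄₀ Y` is its second component, so support preservation
          -- forces that component of `f x` to be `supp x`.
          RelevanceSet.refl Y , ≐-sym (Ren.SuppPreservingMap.supp-preserving f x)
      }
    ; from∘to = record
      { obj≡ = λ X → refl
      ; mor≡ = λ {X} {Y} f x → RelevanceSet.refl Y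
      }
    }

theorem7p10 : (𝔸 : Set) (𝔸↔ℕ : 𝔸 ↔ ℕ) (ℓ : Level) →
    let open Names 𝔸 𝔸↔ℕ in
    IsCategoryEquivalence (∐ ℓ) (𝒮 ℓ) ×
    (∃[ T̄ ] (IsLifting (𝒯 ℓ) T̄ × (Relev ℓ ≅Cat Kleisli T̄)))
theorem7p10 𝔸 𝔸↔ℕ ℓ = ∐𝒮-equivalence , 𝒯̄ , 𝒯̄-lifts-𝒯 , Relev≅Kleisli
  where open RelevanceSets 𝔸 𝔸↔ℕ ℓ
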